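{- Let $\mathrm{Prop}$ be any finite set of propositional variables. Then neither the concept class $\mathbb{C}(\mathcal{F}_{\mathrm{all}},\mathcal{L}_{\Box,\Diamond,\wedge,\bot}[\mathrm{Prop}])$ nor the concept class $\mathbb{C}(\mathcal{F}_{\mathrm{all}},\mathcal{L}_{\Box,\Diamond,\vee,\top}[\mathrm{Prop}])$ admits finite characterisations.
   Context: For a set $S$ of connectives among $\wedge,\vee,\Diamond,\Box,\top,\bot$, $\mathcal{L}_S[\mathrm{Prop}]$ denotes the set of modal formulas generated from the propositional variables in $\mathrm{Prop}$ using only the operators in $S$ (the nullary $\top,\bot$ are formulas by themselves when they belong to $S$). A Kripke model over $\mathrm{Prop}$ is $M=(dom(M),R,v)$ with $R\subseteq dom(M)\times dom(M)$ and $v:dom(M)\to\mathcal{P}(\mathrm{Prop})$; its frame is $(dom(M),R)$; a pointed model is a pair $(M,s)$ with $s\in dom(M)$. Satisfaction is the standard Kripke semantics. $\mathcal{F}_{\mathrm{all}}$ is the class of all frames. For a class $\mathcal{F}$ of frames and a set $\mathcal{L}[\mathrm{Prop}]$ of modal formulas, $\mathbb{C}(\mathcal{F},\mathcal{L}[\mathrm{Prop}])$ is the concept class whose examples are the pointed models over $\mathrm{Prop}$ whose frame is in $\mathcal{F}$, whose concepts are the formulas in $\mathcal{L}[\mathrm{Prop}]$, and in which an example $(M,s)$ is positive for $\varphi$ if $M,s\models\varphi$ and negative otherwise. A formula $\varphi$ fits a pair $(E^+,E^-)$ of finite sets of examples if every element of $E^+$ is a positive example and every element of $E^-$ is a negative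 example for $\varphi$. A finite characterisation of $\varphi$ with respect to this concept class is a pair $(E^+,E^-)$ of finite sets of examples such that $\varphi$ fits $(E^+,E^-)$ and every $\psi\in\mathcal{L}[\mathrm{Prop}]$ that fits $(E^+,E^-)$ has the same positive examples as $\varphi$. The concept class admits finite characterisations if each of its formulas has one. -}

module Defs where

open import Level using (Level; _⊔_; suc; 0ℓ)
open import Data.Empty.Polymorphic using () renaming (⊥ to Empty)
open import Data.List.Base using (List)
open import Data.List.Membership.Propositional using () renaming (_∈_ to _∈ˡ_)
open import Data.List.Relation.Unary.All using (All)
open import Data.Product.Base using (∃; _×_; proj₁; proj₂; ∃-syntax)
open import Data.Sum.Base using (_⊎_)
open import Data.Unit.Polymorphic.Base using () renaming (⊤ to Unit)
open import Function.Bundles using (_⇔_)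
open import Relation.Binary.Core using (Rel)
open import Relation.Nullary.Negation.Core using (¬_)
open import Relation.Unary using (Pred; _∈_; U)

data Connective : Set where
  ∧ᶜ ∨ᶜ ◇ᶜ □ᶜ ⊤ᶜ ⊥ᶜ : Connective

infixr 7 _∧_
infixr 6 _∨_
infix  8 ◇_ □_

data Formula {p : Level} (P : Set p) : Set p where
  var     : P → Formula P
  ⊤ ⊥     : Formula P
  _∧_ _∨_ : Formula P → Formula P → Formula P
  ◇_ □_   : Formula P → Formula P

data 𝓛 {p : Level} (S : List Connective) (P : Set p) : Pred (Formula P) p where
  var : ∀ x → var x ∈ 𝓛 S P
  top : ⊤ᶜ ∈ˡ S → ⊤ ∈ 𝓛 S P
  bot : ⊥ᶜ ∈ˡ S → ⊥ ∈ 𝓛 S P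
  and : ∀ {φ ψ} → ∧ᶜ ∈ˡ S → φ ∈ 𝓛 S P → ψ ∈ 𝓛 S P → (φ ∧ ψ) ∈ 𝓛 S P
  or  : ∀ {φ ψ} → ∨ᶜ ∈ˡ S → φ ∈ 𝓛 S P → ψ ∈ 𝓛 S P → (φ ∨ ψ) ∈ 𝓛 S P
  dia : ∀ {φ} → ◇ᶜ ∈ˡ S → φ ∈ 𝓛 S P → (◇ φ) ∈ 𝓛 S P
  box : ∀ {φ} → □ᶜ ∈ˡ S → φ ∈ 𝓛 S P → (□ φ) ∈ 𝓛 S P

record Frame (ℓ : Level) : Set (suc ℓ) where
  field
    dom : Set ℓ
    R   : Rel dom ℓ

record Model {p : Level} (P : Set p) (ℓ : Level) : Set (p ⊔ suc ℓ) where
  field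
    frame : Frame ℓ
  open Frame frame public
  field
    v : dom → Pred P ℓ

record PointedModel {p : Level} (P : Set p) (ℓ : Level) : Set (p ⊔ suc ℓ) where
  constructor pointed
  field
    model : Model P ℓ
    point : Model.dom model
  open Model model public

infix 4 _,_⊨_

_,_⊨_ : ∀ {p ℓ} {P : Set p} (M : Model P ℓ) → Model.dom M → Formula P → Set ℓ
M , s ⊨ var x = x ∈ Model.v M s
M , s ⊨ ⊤     = Unit
M , s ⊨ ⊥     = Empty
M , s ⊨ φ ∧ ψ = (M , s ⊨ φ) × (M , s ⊨ ψ)
M , s ⊨ φ ∨ ψ = (M , s ⊨ φ) ⊎ (M , s ⊨ ψ)
M , s ⊨ ◇ φ   = ∃[ t ] Model.R M s t × (M , t ⊨ φ)
M , s ⊨ □ φ   = ∀ t → Model.R M s t → M , t ⊨ φ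

FrameClass : (ℓ k : Level) → Set (suc ℓ ⊔ suc k)
FrameClass ℓ k = Pred (Frame ℓ) k

𝓕-all : ∀ {ℓ} → FrameClass ℓ 0ℓ
𝓕-all = U

record ConceptClass (e c ℓ : Level) : Set (suc (e ⊔ c ⊔ ℓ)) where
  field
    Example  : Set e
    Concept  : Set c
    Positive : Concept → Pred Example ℓ

  Negative : Concept → Pred Example ℓ
  Negative φ x = ¬ Positive φ x

  SamePositives : Concept → Concept → Set (e ⊔ ℓ)
  SamePositives ψ φ = ∀ x → Positive ψ x ⇔ Positive φ x

  -- Finite sets of examples are given by enumerating lists; order and
  -- repetitions play no role in fitting.
  Fits : Concept → List Example × List Example → Set (e ⊔ ℓ)
  Fits φ E = All (Positive φ) (proj₁ E) × All (Negative φ) (proj₂ E)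

  IsFiniteCharacterisation : Concept → List Example × List Example → Set (e ⊔ c ⊔ ℓ)
  IsFiniteCharacterisation φ E = Fits φ E × (∀ ψ → Fits ψ E → SamePositives ψ φ)

  AdmitsFiniteCharacterisations : Set (e ⊔ c ⊔ ℓ)
  AdmitsFiniteCharacterisations = ∀ φ → ∃[ E ] IsFiniteCharacterisation φ E

open ConceptClass public using (AdmitsFiniteCharacterisations)

ℂ : ∀ {p ℓ k q} {P : Set p} → FrameClass ℓ k → Pred (Formula P) q →
    ConceptClass (p ⊔ suc ℓ ⊔ k) (p ⊔ q) ℓ
ℂ {ℓ = ℓ} {P = P} 𝓕 L = record
  { Example  = ∃[ x ] PointedModel.frame {P = P} {ℓ} x ∈ 𝓕
  ; Concept  = ∃[ φ ] φ ∈ L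
  ; Positive = λ φ x → PointedModel.model (proj₁ x) , PointedModel.point (proj₁ x) ⊨ proj₁ φ
  }

{-# OPTIONS --safe #-}
-- Neither ⊥ (in the first language) nor ⊤ (in the second) has a finite
-- characterisation.  The formula  ◇ⁿ □ ⊥ ∧ □ⁿ⁺¹ ⊥  says that the longest path
-- from the current point has length exactly n.  It is satisfiable for each n,
-- but a given pointed model satisfies it for at most one n, so finitely many
-- negative examples for ⊥ cannot exclude all these formulas.  The argument
-- for ⊤ is dual, with  □ⁿ ◇ ⊤ ∨ ◇ⁿ⁺¹ ⊤.
module Submission where

open import Defs
open import Level using (Level; Lift; lift)
open import Data.Empty.Polymorphic using (⊥-elim) renaming (⊥ to Empty)
open import Data.Fin.Base using (Fin)
open import Data.List.Base using ([]; _∷_)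
open import Data.List.Relation.Unary.All as All using (All; []; _∷_)
open import Data.List.Relation.Unary.Any using (here; there)
open import Data.Nat.Base using (ℕ; zero; suc; _≤_; _<_; s≤s)
open import Data.Nat.Properties using (≤-refl; ≤-trans; <⇒≤)
open import Data.Product.Base using (∃-syntax; _×_; _,_; proj₁)
open import Data.Sum.Base using (inj₁; inj₂)
open import Data.Unit.Polymorphic.Base using (tt)
open import Function.Base using (_∘_)
open import Function.Bundles using (_↔_; module Equivalence)
open import Relation.Binary.PropositionalEquality.Core using (refl)
open import Relation.Nullary.Decidable.Core using (yes; no; ¬¬-excluded-middle)
open import Relation.Nullary.Negation.Core using (¬_; contradiction)
open import Relation.Unary using (Pred; _∈_)

private
  variable
    a p q ℓ : Level
    P : Set p

-- Each element rules out at most one index, so the search moves past that index whenever it meets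
-- one. The lower bound `k` keeps the indices found by the recursion beyond it. Whether `Q m x`
-- holds is undecidable here, hence the double negation.
¬¬∃-All : {A : Set a} (Q : ℕ → Pred A q) →
          (∀ {m n x} → m < n → ¬ Q m x → Q n x) →
          ∀ xs k → ¬ ¬ (∃[ n ] k ≤ n × All (Q n) xs)
¬¬∃-All Q fails-once []       k none = none (k , ≤-refl , [])
¬¬∃-All Q fails-once (x ∷ xs) k none =
  ¬¬∃-All Q fails-once xs k λ (m , k≤m , Qm) →
  ¬¬-excluded-middle λ where
    (yes Qmx) → none (m , k≤m , Qmx ∷ Qm)
    -- The search over `xs` restarts above `m`, where `x` can no longer fail.
    (no ¬Qmx) → ¬¬∃-All Q fails-once xs (suc m) λ (n , m<n , Qn) →
      none (n , ≤-trans k≤m (<⇒≤ m<n) , fails-once m<n ¬Qmx ∷ Qn)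

infix 8 ◇^ □^

◇^ □^ : ℕ → Formula P → Formula P
◇^ zero    φ = φ
◇^ (suc n) φ = ◇ ◇^ n φ
□^ zero    φ = φ
□^ (suc n) φ = □ □^ n φ

◇^-∈ : ∀ {S} {φ : Formula P} n → φ ∈ 𝓛 (□ᶜ ∷ ◇ᶜ ∷ S) P → ◇^ n φ ∈ 𝓛 (□ᶜ ∷ ◇ᶜ ∷ S) P
◇^-∈ zero    φ∈ = φ∈
◇^-∈ (suc n) φ∈ = dia (there (here refl)) (◇^-∈ n φ∈)

□^-∈ : ∀ {S} {φ : Formula P} n → φ ∈ 𝓛 (□ᶜ ∷ ◇ᶜ ∷ S) P → □^ n φ ∈ 𝓛 (□ᶜ ∷ ◇ᶜ ∷ S) P
□^-∈ zero    φ∈ = φ∈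
□^-∈ (suc n) φ∈ = box (here refl) (□^-∈ n φ∈)

module _ (M : Model P ℓ) where

  -- A path of length `n` would have an initial segment of length `suc m`, ending where `⊥` holds.
  □^⊥⇒¬◇^ : ∀ {m n s φ} → m < n → M , s ⊨ □^ (suc m) ⊥ → ¬ (M , s ⊨ ◇^ n φ)
  □^⊥⇒¬◇^ {zero}  {suc n} _         □⊥  (t , sRt , _)   = ⊥-elim (□⊥ t sRt)
  □^⊥⇒¬◇^ {suc m} {suc n} (s≤s m<n) □^⊥ (t , sRt , ◇^φ) = □^⊥⇒¬◇^ m<n (□^⊥ t sRt) ◇^φ

  -- With no path of length `suc m` there is none of length `n`, so the boxes hold vacuously.
  ¬◇^⊤⇒□^ : ∀ {m n s φ} → m < n → ¬ (M , s ⊨ ◇^ (suc m) ⊤) → M , s ⊨ □^ n φ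
  ¬◇^⊤⇒□^ {zero}  {suc n} _         ¬◇⊤  t sRt = contradiction (t , sRt , tt) ¬◇⊤
  ¬◇^⊤⇒□^ {suc m} {suc n} (s≤s m<n) ¬◇^⊤ t sRt =
    ¬◇^⊤⇒□^ m<n λ ◇^⊤ → ¬◇^⊤ (t , sRt , ◇^⊤)

hasHeight lacksHeight : ℕ → Formula P
hasHeight   n = ◇^ n (□ ⊥) ∧ □^ (suc n) ⊥
lacksHeight n = □^ n (◇ ⊤) ∨ ◇^ (suc n) ⊤

hasHeight-∈ : ∀ n → hasHeight n ∈ 𝓛 (□ᶜ ∷ ◇ᶜ ∷ ∧ᶜ ∷ ⊥ᶜ ∷ []) P
hasHeight-∈ n = and (there (there (here refl)))
  (◇^-∈ n (box (here refl) ⊥∈)) (□^-∈ (suc n) ⊥∈)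
  where ⊥∈ = bot (there (there (there (here refl))))

lacksHeight-∈ : ∀ n → lacksHeight n ∈ 𝓛 (□ᶜ ∷ ◇ᶜ ∷ ∨ᶜ ∷ ⊤ᶜ ∷ []) P
lacksHeight-∈ n = or (there (there (here refl)))
  (□^-∈ n (dia (there (here refl)) ⊤∈)) (◇^-∈ (suc n) ⊤∈)
  where ⊤∈ = top (there (there (there (here refl))))

data _↝_ {ℓ} : Lift ℓ ℕ → Lift ℓ ℕ → Set ℓ where
  step : ∀ {n} → lift (suc n) ↝ lift n

-- The only maximal path from `lift n` counts down to 0, so this one model provides a point of every
-- finite height.
descending : Model P ℓ
descending {ℓ = ℓ} = record
  { frame = record { dom = Lift ℓ ℕ ; R = _↝_ }
  ; v     = λ _ _ → Lift ℓ ℕ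
  }

descending-hasHeight : ∀ n → descending {P = P} {ℓ} , lift n ⊨ hasHeight n
descending-hasHeight zero    = (λ _ ()) , (λ _ ())
descending-hasHeight (suc n) with descending-hasHeight n
... | ◇^□⊥ , □^⊥ = (lift n , step , ◇^□⊥) , λ { _ step → □^⊥ }

descending-¬lacksHeight : ∀ n → ¬ (descending {P = P} {ℓ} , lift n ⊨ lacksHeight n)
descending-¬lacksHeight zero    (inj₁ (_ , () , _))
descending-¬lacksHeight zero    (inj₂ (_ , () , _))
descending-¬lacksHeight (suc n) (inj₁ □^◇⊤)             =
  descending-¬lacksHeight n (inj₁ (□^◇⊤ (lift n) step))
descending-¬lacksHeight (suc n) (inj₂ (_ , step , ◇^⊤)) =
  descending-¬lacksHeight n (inj₂ ◇^⊤)

theorem3p11 : ∀ {p ℓ} (P : Set p) → ∃[ n ] (P ↔ Fin n) →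
    ¬ AdmitsFiniteCharacterisations (ℂ (𝓕-all {ℓ}) (𝓛 (□ᶜ ∷ ◇ᶜ ∷ ∧ᶜ ∷ ⊥ᶜ ∷ []) P))
    × ¬ AdmitsFiniteCharacterisations (ℂ (𝓕-all {ℓ}) (𝓛 (□ᶜ ∷ ◇ᶜ ∷ ∨ᶜ ∷ ⊤ᶜ ∷ []) P))
theorem3p11 {ℓ = ℓ} P _ = no-characterisation-of-⊥ , no-characterisation-of-⊤
  where
  ℂ⊥ = ℂ (𝓕-all {ℓ}) (𝓛 (□ᶜ ∷ ◇ᶜ ∷ ∧ᶜ ∷ ⊥ᶜ ∷ []) P)
  ℂ⊤ = ℂ (𝓕-all {ℓ}) (𝓛 (□ᶜ ∷ ◇ᶜ ∷ ∨ᶜ ∷ ⊤ᶜ ∷ []) P)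

  no-characterisation-of-⊥ : ¬ AdmitsFiniteCharacterisations ℂ⊥
  no-characterisation-of-⊥ admits
    with admits (⊥ , bot (there (there (there (here refl)))))
  ... | (E⁺ , E⁻) , (⊥-pos , _) , unique =
    ¬¬∃-All (λ n → Negative (hasHeight n , hasHeight-∈ n))
      -- Failing to be negative yields only a doubly negated `hasHeight m`, which suffices for a
      -- contradiction.
      (λ {x = x} m<n ¬¬height-m (◇^□⊥ , _) →
        ¬¬height-m λ (_ , □^⊥) → □^⊥⇒¬◇^ (PointedModel.model (proj₁ x)) m<n □^⊥ ◇^□⊥)
      E⁻ 0
      λ (n , _ , neg) → ⊥-elim (Equivalence.to
        -- Every member of `E⁺` satisfies `⊥`, hence any formula.
        (unique (hasHeight n , hasHeight-∈ n) (All.map ⊥-elim ⊥-pos , neg)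
          (pointed descending (lift n) , _))
        (descending-hasHeight n))
    where open ConceptClass ℂ⊥

  no-characterisation-of-⊤ : ¬ AdmitsFiniteCharacterisations ℂ⊤
  no-characterisation-of-⊤ admits
    with admits (⊤ , top (there (there (there (here refl)))))
  ... | (E⁺ , E⁻) , (_ , ⊤-neg) , unique =
    ¬¬∃-All (λ n → Positive (lacksHeight n , lacksHeight-∈ n))
      (λ {x = x} m<n height-m →
        -- If `lacksHeight m` fails, so does its second disjunct, and this bounds the path lengths.
        inj₁ (¬◇^⊤⇒□^ (PointedModel.model (proj₁ x)) m<n (height-m ∘ inj₂)))
      E⁺ 0
      λ (n , _ , pos) → descending-¬lacksHeight n (Equivalence.from
        (unique (lacksHeight n , lacksHeight-∈ n) (pos , All.map (contradiction tt) ⊤-neg)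
          (pointed descending (lift n) , _))
        tt)
    where open ConceptClass ℂ⊤
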